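{- Let $\tau \geq 1$ be a real number, and let $\mathcal{S}$ be a finite set of integers of the form $\lfloor \tau k \rfloor$ with $k \in \mathbb{N}$, containing at least one nonzero element. Let $\hat{x} = \lfloor \tau \hat{n} \rfloor$, with $\hat{n} \in \mathbb{N}$, denote the largest integer in $\mathcal{S}$, and let $n$ denote the number of nonzero elements of $\mathcal{S}$. Then $$\tau < \frac{\hat{x}+1}{\hat{n}} \leq \frac{\hat{x}+1}{n}.$$
   Context: $\mathbb{N} = \{0,1,2,\dots\}$. The set $\mathcal{S}$ represents the set of distinct values observed in a finite sample of $X = \lfloor \tau N \rfloor$, with $N$ an $\mathbb{N}$-valued random variable. -}

module Defs where

open import Data.Integer.Base as ℤ using (ℤ; 0ℤ; 1ℤ)
import Data.Integer.Properties as ℤ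
open import Data.List.Base using (List; length; filter)
open import Data.List.Membership.Propositional using (_∈_)
open import Data.List.Relation.Unary.All using (All)
open import Data.Nat.Base as ℕ using (ℕ)
import Data.Nat.Properties as ℕ
open import Data.Product.Base using (_×_; _,_; Σ-syntax; ∃-syntax)
open import Data.Rational.Base as ℚ using (ℚ; 0ℚ; 1ℚ; ∣_∣)
import Data.Rational.Properties as ℚ
open import Data.Rational.Solver using (module +-*-Solver)
open import Relation.Binary.PropositionalEquality
  using (_≡_; refl; sym; cong; cong₂; subst)
open import Relation.Nullary.Decidable using (¬?)
open import Relation.Nullary.Negation using (¬_)

-- Real numbers are represented by Cauchy sequences of rationals.  There is no
-- quotient: equality of reals is mutual _≤_, which _<_, _≤_ and _*_ respect.

IsCauchy : (ℕ → ℚ) → Set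
IsCauchy x = ∀ ε → 0ℚ ℚ.< ε →
  ∃[ N ] ∀ m n → N ℕ.≤ m → N ℕ.≤ n → ∣ x m ℚ.- x n ∣ ℚ.< ε

record ℝ : Set where
  constructor mkℝ
  field
    seq    : ℕ → ℚ
    cauchy : IsCauchy seq

open ℝ public

fromℚ : ℚ → ℝ
fromℚ q .seq _ = q
fromℚ q .cauchy ε 0<ε =
  0 , λ _ _ _ _ → subst (λ r → ∣ r ∣ ℚ.< ε) (sym (ℚ.+-inverseʳ q)) 0<ε

fromℤ : ℤ → ℝ
fromℤ i = fromℚ (i ℚ./ 1)

fromℕ : ℕ → ℝ
fromℕ k = fromℤ (ℤ.+ k)

infix 4 _<_ _≤_ _≥_

_<_ : ℝ → ℝ → Set
x < y = Σ[ ε ∈ ℚ ] 0ℚ ℚ.< ε ×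
  (∃[ N ] ∀ n → N ℕ.≤ n → seq x n ℚ.+ ε ℚ.≤ seq y n)

_≤_ : ℝ → ℝ → Set
x ≤ y = ¬ (y < x)

_≥_ : ℝ → ℝ → Set
x ≥ y = y ≤ x

private
  open +-*-Solver

  add-sub : ∀ p q → p ≡ p ℚ.- q ℚ.+ q
  add-sub = solve 2 (λ p q → p := p :- q :+ q) refl

  product-diff : ∀ a b a′ b′ →
    a ℚ.* b ℚ.- a′ ℚ.* b′ ≡ a ℚ.* (b ℚ.- b′) ℚ.+ (a ℚ.- a′) ℚ.* b′
  product-diff = solve 4 (λ a b a′ b′ →
    a :* b :- a′ :* b′ := a :* (b :- b′) :+ (a :- a′) :* b′) refl

  factor : ∀ a b d → a ℚ.* d ℚ.+ d ℚ.* b ≡ d ℚ.* (a ℚ.+ b)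
  factor = solve 3 (λ a b d → a :* d :+ d :* b := d :* (a :+ b)) refl

  divide : ∀ ε C → 0ℚ ℚ.< ε → 0ℚ ℚ.< C → Σ[ δ ∈ ℚ ] 0ℚ ℚ.< δ × δ ℚ.* C ≡ ε
  divide ε C 0<ε 0<C = ε ℚ.* c , 0<εc , εcC≡ε
    where
    instance
      ε-pos : ℚ.Positive ε
      ε-pos = ℚ.positive 0<ε
      C-pos : ℚ.Positive C
      C-pos = ℚ.positive 0<C
      C-nonZero : ℚ.NonZero C
      C-nonZero = ℚ.pos⇒nonZero C
    c : ℚ
    c = ℚ.1/ C
    0<εc : 0ℚ ℚ.< ε ℚ.* c
    0<εc = subst (ℚ._< ε ℚ.* c) (ℚ.*-zeroʳ ε)
      (ℚ.*-monoʳ-<-pos ε (ℚ.positive⁻¹ c {{ℚ.1/pos⇒pos C}}))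
    εcC≡ε : ε ℚ.* c ℚ.* C ≡ ε
    εcC≡ε = begin-equality
      ε ℚ.* c ℚ.* C    ≡⟨ ℚ.*-assoc ε c C ⟩
      ε ℚ.* (c ℚ.* C)  ≡⟨ cong (ε ℚ.*_) (ℚ.*-inverseˡ C) ⟩
      ε ℚ.* 1ℚ         ≡⟨ ℚ.*-identityʳ ε ⟩
      ε                ∎
      where open ℚ.≤-Reasoning

  product-close : ∀ {A B δ a b a′ b′} → 0ℚ ℚ.< A → 0ℚ ℚ.< B →
    ∣ a ∣ ℚ.< A → ∣ b′ ∣ ℚ.< B → ∣ a ℚ.- a′ ∣ ℚ.< δ → ∣ b ℚ.- b′ ∣ ℚ.< δ →
    ∣ a ℚ.* b ℚ.- a′ ℚ.* b′ ∣ ℚ.< δ ℚ.* (A ℚ.+ B)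
  product-close {A} {B} {δ} {a} {b} {a′} {b′} 0<A 0<B a<A b′<B Δa<δ Δb<δ =
    begin-strict
      ∣ a ℚ.* b ℚ.- a′ ℚ.* b′ ∣
        ≡⟨ cong ∣_∣ (product-diff a b a′ b′) ⟩
      ∣ a ℚ.* Δb ℚ.+ Δa ℚ.* b′ ∣
        ≤⟨ ℚ.∣p+q∣≤∣p∣+∣q∣ (a ℚ.* Δb) (Δa ℚ.* b′) ⟩
      ∣ a ℚ.* Δb ∣ ℚ.+ ∣ Δa ℚ.* b′ ∣
        ≡⟨ cong₂ ℚ._+_ (ℚ.∣p*q∣≡∣p∣*∣q∣ a Δb) (ℚ.∣p*q∣≡∣p∣*∣q∣ Δa b′) ⟩
      ∣ a ∣ ℚ.* ∣ Δb ∣ ℚ.+ ∣ Δa ∣ ℚ.* ∣ b′ ∣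
        ≤⟨ ℚ.+-mono-≤
             (ℚ.*-monoʳ-≤-nonNeg ∣ Δb ∣ {{ℚ.∣-∣-nonNeg Δb}} (ℚ.<⇒≤ a<A))
             (ℚ.*-monoˡ-≤-nonNeg ∣ Δa ∣ {{ℚ.∣-∣-nonNeg Δa}} (ℚ.<⇒≤ b′<B)) ⟩
      A ℚ.* ∣ Δb ∣ ℚ.+ ∣ Δa ∣ ℚ.* B
        <⟨ ℚ.+-mono-<
             (ℚ.*-monoʳ-<-pos A {{ℚ.positive 0<A}} Δb<δ)
             (ℚ.*-monoˡ-<-pos B {{ℚ.positive 0<B}} Δa<δ) ⟩
      A ℚ.* δ ℚ.+ δ ℚ.* B
        ≡⟨ factor A B δ ⟩
      δ ℚ.* (A ℚ.+ B) ∎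
    where
    open ℚ.≤-Reasoning
    Δa Δb : ℚ
    Δa = a ℚ.- a′
    Δb = b ℚ.- b′

eventuallyBounded : ∀ {x} → IsCauchy x →
  Σ[ B ∈ ℚ ] 0ℚ ℚ.< B × (∃[ N ] ∀ n → N ℕ.≤ n → ∣ x n ∣ ℚ.< B)
eventuallyBounded {x} c with c 1ℚ (ℚ.positive⁻¹ 1ℚ)
... | N , close = 1ℚ ℚ.+ ∣ x N ∣ , 0<B , N , bound
  where
  0<B : 0ℚ ℚ.< 1ℚ ℚ.+ ∣ x N ∣
  0<B = ℚ.+-mono-<-≤ (ℚ.positive⁻¹ 1ℚ) (ℚ.0≤∣p∣ (x N))
  bound : ∀ n → N ℕ.≤ n → ∣ x n ∣ ℚ.< 1ℚ ℚ.+ ∣ x N ∣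
  bound n N≤n = begin-strict
    ∣ x n ∣                      ≡⟨ cong ∣_∣ (add-sub (x n) (x N)) ⟩
    ∣ (x n ℚ.- x N) ℚ.+ x N ∣    ≤⟨ ℚ.∣p+q∣≤∣p∣+∣q∣ (x n ℚ.- x N) (x N) ⟩
    ∣ x n ℚ.- x N ∣ ℚ.+ ∣ x N ∣  <⟨ ℚ.+-monoˡ-< ∣ x N ∣ (close n N N≤n ℕ.≤-refl) ⟩
    1ℚ ℚ.+ ∣ x N ∣               ∎
    where open ℚ.≤-Reasoning

-- Destructuring with `let` rather than `with` keeps typechecking fast:
-- with-abstraction would normalise rational arithmetic in the goal.

*-cauchy : ∀ {x y} → IsCauchy x → IsCauchy y → IsCauchy (λ n → x n ℚ.* y n)
*-cauchy {x} {y} cx cy ε 0<ε =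
  let A , 0<A , N₁ , x<A  = eventuallyBounded {x} cx
      B , 0<B , N₂ , y<B  = eventuallyBounded {y} cy
      δ , 0<δ , δ[A+B]≡ε  = divide ε (A ℚ.+ B) 0<ε (ℚ.+-mono-< 0<A 0<B)
      N₃ , x-close        = cx δ 0<δ
      N₄ , y-close        = cy δ 0<δ
      N₁₂                 = N₁ ℕ.⊔ N₂
      N₃₄                 = N₃ ℕ.⊔ N₄
  in  N₁₂ ℕ.⊔ N₃₄ , λ m n N≤m N≤n →
    let N₁₂≤m = ℕ.m⊔n≤o⇒m≤o N₁₂ N₃₄ N≤m
        N₁₂≤n = ℕ.m⊔n≤o⇒m≤o N₁₂ N₃₄ N≤n
        N₃₄≤m = ℕ.m⊔n≤o⇒n≤o N₁₂ N₃₄ N≤m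
        N₃₄≤n = ℕ.m⊔n≤o⇒n≤o N₁₂ N₃₄ N≤n
    in subst (∣ x m ℚ.* y m ℚ.- x n ℚ.* y n ∣ ℚ.<_) δ[A+B]≡ε
         (product-close {A} {B} {δ} {x m} {y m} {x n} {y n} 0<A 0<B
           (x<A m (ℕ.m⊔n≤o⇒m≤o N₁ N₂ N₁₂≤m))
           (y<B n (ℕ.m⊔n≤o⇒n≤o N₁ N₂ N₁₂≤n))
           (x-close m n (ℕ.m⊔n≤o⇒m≤o N₃ N₄ N₃₄≤m) (ℕ.m⊔n≤o⇒m≤o N₃ N₄ N₃₄≤n))
           (y-close m n (ℕ.m⊔n≤o⇒n≤o N₃ N₄ N₃₄≤m) (ℕ.m⊔n≤o⇒n≤o N₃ N₄ N₃₄≤n)))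

infixl 7 _*_

_*_ : ℝ → ℝ → ℝ
(x * y) .seq n  = seq x n ℚ.* seq y n
(x * y) .cauchy = *-cauchy {seq x} {seq y} (cauchy x) (cauchy y)

-- The floor is not a computable function on ℝ, so ⌊ x ⌋ = i is stated as the
-- relation i ≤ x < i + 1, which determines i.

infix 4 ⌊_⌋≡_

⌊_⌋≡_ : ℝ → ℤ → Set
⌊ x ⌋≡ i = fromℤ i ≤ x × x < fromℤ (i ℤ.+ 1ℤ)

IsLargestIn : ℤ → List ℤ → Set
IsLargestIn i S = i ∈ S × All (ℤ._≤ i) S

-- On duplicate-free lists this is the cardinality of S ∖ {0}.

countNonzero : List ℤ → ℕ
countNonzero S = length (filter (λ i → ¬? (i ℤ.≟ 0ℤ)) S)

{-# OPTIONS --safe #-}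
-- Since τ ≥ 1, the map k ↦ ⌊τk⌋ is strictly increasing.  So each nonzero
-- element of S is ⌊τk⌋ for some k in {1, …, n̂}, distinct elements have distinct
-- k, and n ≤ n̂ by the pigeonhole principle.  The bound on τ is τ n̂ < x̂ + 1.
module Submission where

open import Defs
open import Data.Fin.Base using (zero; suc; fromℕ<)
open import Data.Fin.Properties using (fromℕ<-injective; injective⇒≤)
open import Data.Integer.Base as ℤ using (ℤ; 0ℤ; 1ℤ)
import Data.Integer.Properties as ℤ
open import Data.List.Base using (List; length; lookup; filter)
open import Data.List.Properties using (filter-some)
open import Data.List.Relation.Unary.All as All using (All)
import Data.List.Relation.Unary.All.Properties as All
open import Data.List.Relation.Unary.AllPairs using (_∷_)
open import Data.List.Relation.Unary.Any using (Any)
open import Data.List.Membership.Propositional.Properties using (∈-lookup)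
open import Data.List.Relation.Unary.Unique.Propositional using (Unique)
import Data.List.Relation.Unary.Unique.Propositional.Properties as Unique
open import Data.Nat.Base as ℕ using (ℕ; zero; suc)
import Data.Nat.Properties as ℕ
open import Data.Product.Base using (_×_; _,_; proj₂; Σ-syntax; ∃-syntax)
open import Data.Rational.Base as ℚ using (ℚ; _/_; 0ℚ; 1ℚ; ½; toℚᵘ)
import Data.Rational.Properties as ℚ
open import Data.Rational.Solver using (module +-*-Solver)
import Data.Rational.Unnormalised.Base as ℚᵘ
import Data.Rational.Unnormalised.Properties as ℚᵘ
open import Data.Sum.Base using (inj₁; inj₂)
open import Function.Base using (_∘_)
open import Relation.Binary.PropositionalEquality
  using (_≡_; _≢_; refl; sym; cong; cong₂; subst)
open import Relation.Nullary.Decidable using (¬?)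
open import Relation.Nullary.Negation using (contradiction)

open +-*-Solver

-- Fractions of integers in `ℚ`.

toℚᵘ-/ : ∀ i n .{{_ : ℕ.NonZero n}} → toℚᵘ (i / n) ℚᵘ.≃ i ℚᵘ./ n
toℚᵘ-/ i (suc n) = ℚ.toℚᵘ-fromℚᵘ (ℚᵘ.mkℚᵘ i n)

-- Reduction by the gcd hides the numerator and denominator of `i / m`. For unnormalised rationals
-- the order is cross-multiplication itself, so the hypothesis is already the proof there.
/-mono-≤ : ∀ i j m n .{{_ : ℕ.NonZero m}} .{{_ : ℕ.NonZero n}} →
  i ℤ.* ℤ.+ n ℤ.≤ j ℤ.* ℤ.+ m → i / m ℚ.≤ j / n
/-mono-≤ i j m@(suc _) n@(suc _) in≤jm = ℚ.toℚᵘ-cancel-≤ (begin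
  toℚᵘ (i / m)  ≃⟨ toℚᵘ-/ i m ⟩
  i ℚᵘ./ m      ≤⟨ ℚᵘ.*≤* in≤jm ⟩
  j ℚᵘ./ n      ≃⟨ toℚᵘ-/ j n ⟨
  toℚᵘ (j / n)  ∎)
  where open ℚᵘ.≤-Reasoning

/1-mono-≤ : ∀ {i j} → i ℤ.≤ j → i / 1 ℚ.≤ j / 1
/1-mono-≤ {i} {j} i≤j = /-mono-≤ i j 1 1 (ℤ.*-monoʳ-≤-nonNeg 1ℤ i≤j)

/1-homo-+ : ∀ i j → (i ℤ.+ j) / 1 ≡ i / 1 ℚ.+ j / 1
/1-homo-+ i j = ℚ.toℚᵘ-injective (begin-equality
  toℚᵘ ((i ℤ.+ j) / 1)               ≃⟨ toℚᵘ-/ (i ℤ.+ j) 1 ⟩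
  (i ℤ.+ j) ℚᵘ./ 1                   ≡⟨ cong₂ (λ a b → (a ℤ.+ b) ℚᵘ./ 1) (ℤ.*-identityʳ i) (ℤ.*-identityʳ j) ⟨
  i ℚᵘ./ 1 ℚᵘ.+ j ℚᵘ./ 1             ≃⟨ ℚᵘ.+-cong (toℚᵘ-/ i 1) (toℚᵘ-/ j 1) ⟨
  toℚᵘ (i / 1) ℚᵘ.+ toℚᵘ (j / 1)     ≃⟨ ℚ.toℚᵘ-homo-+ (i / 1) (j / 1) ⟨
  toℚᵘ (i / 1 ℚ.+ j / 1)             ∎)
  where open ℚᵘ.≤-Reasoning

/-*-cancel : ∀ i n .{{_ : ℕ.NonZero n}} → i / n ℚ.* (ℤ.+ n / 1) ≡ i / 1
/-*-cancel i n@(suc _) = ℚ.toℚᵘ-injective (begin-equality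
  toℚᵘ (i / n ℚ.* (ℤ.+ n / 1))            ≃⟨ ℚ.toℚᵘ-homo-* (i / n) (ℤ.+ n / 1) ⟩
  toℚᵘ (i / n) ℚᵘ.* toℚᵘ (ℤ.+ n / 1)      ≃⟨ ℚᵘ.*-cong (toℚᵘ-/ i n) (toℚᵘ-/ (ℤ.+ n) 1) ⟩
  i ℚᵘ./ n ℚᵘ.* (ℤ.+ n ℚᵘ./ 1)            ≃⟨ ℚᵘ.*≡* (ℤ.*-assoc i (ℤ.+ n) 1ℤ) ⟩
  i ℚᵘ./ 1                                ≃⟨ toℚᵘ-/ i 1 ⟨
  toℚᵘ (i / 1)                            ∎)
  where open ℚᵘ.≤-Reasoning

p≤∣p∣ : ∀ p → p ℚ.≤ ℚ.∣ p ∣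
p≤∣p∣ p with ℚ.≤-total 0ℚ p
... | inj₁ 0≤p = ℚ.≤-reflexive (sym (ℚ.0≤p⇒∣p∣≡p 0≤p))
... | inj₂ p≤0 = ℚ.≤-trans p≤0 (ℚ.0≤∣p∣ p)

p<p+q : ∀ {q} p → 0ℚ ℚ.< q → p ℚ.< p ℚ.+ q
p<p+q {q} p 0<q = subst (ℚ._< p ℚ.+ q) (ℚ.+-identityʳ p) (ℚ.+-monoʳ-< p 0<q)

+-cancelʳ-≤ : ∀ r {p q} → p ℚ.+ r ℚ.≤ q ℚ.+ r → p ℚ.≤ q
+-cancelʳ-≤ r p+r≤q+r =
  ℚ.≮⇒≥ λ q<p → ℚ.<-irrefl refl (ℚ.<-≤-trans (ℚ.+-monoˡ-< r q<p) p+r≤q+r)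

0<*-pos : ∀ {p} q .{{_ : ℚ.Positive q}} → 0ℚ ℚ.< p → 0ℚ ℚ.< p ℚ.* q
0<*-pos {p} q 0<p =
  subst (ℚ._< p ℚ.* q) (ℚ.*-zeroˡ q) (ℚ.*-monoˡ-<-pos q 0<p)

-- Order between reals and rationals.

fromℚ-mono-≤ : ∀ {p q} → p ℚ.≤ q → fromℚ p ≤ fromℚ q
fromℚ-mono-≤ {p} {q} p≤q (ε , 0<ε , N , q+ε≤p) =
  ℚ.<-irrefl refl
    (ℚ.<-≤-trans (p<p+q q 0<ε) (ℚ.≤-trans (q+ε≤p N ℕ.≤-refl) p≤q))

<-fromℚ-trans : ∀ x {p q} → x < fromℚ p → p ℚ.≤ q → x < fromℚ q
<-fromℚ-trans x (ε , 0<ε , N , x+ε≤p) p≤q =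
  ε , 0<ε , N , λ m N≤m → ℚ.≤-trans (x+ε≤p m N≤m) p≤q

*-cancelʳ-<-fromℚ : ∀ x q c .{{_ : ℚ.Positive c}} →
  x * fromℚ c < fromℚ (q ℚ.* c) → x < fromℚ q
*-cancelʳ-<-fromℚ x q c (ε , 0<ε , N , xc+ε≤qc) =
  -- The gap is divided by `c` so that multiplying back by `c` restores the given `ε`.
  ε ℚ.* c⁻¹ , 0<*-pos c⁻¹ 0<ε , N , λ m N≤m → ℚ.*-cancelʳ-≤-pos c (begin
    (seq x m ℚ.+ ε ℚ.* c⁻¹) ℚ.* c
      ≡⟨ distrib (seq x m) ε c⁻¹ c ⟩
    seq x m ℚ.* c ℚ.+ ε ℚ.* (c⁻¹ ℚ.* c)
      ≡⟨ cong (λ u → seq x m ℚ.* c ℚ.+ ε ℚ.* u) (ℚ.*-inverseˡ c) ⟩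
    seq x m ℚ.* c ℚ.+ ε ℚ.* 1ℚ
      ≡⟨ cong (seq x m ℚ.* c ℚ.+_) (ℚ.*-identityʳ ε) ⟩
    seq x m ℚ.* c ℚ.+ ε
      ≤⟨ xc+ε≤qc m N≤m ⟩
    q ℚ.* c ∎)
  where
  open ℚ.≤-Reasoning
  instance
    c≢0 : ℚ.NonZero c
    c≢0 = ℚ.pos⇒nonZero c
  c⁻¹ : ℚ
  c⁻¹ = ℚ.1/ c
  instance
    c⁻¹-pos : ℚ.Positive c⁻¹
    c⁻¹-pos = ℚ.1/pos⇒pos c
  distrib : ∀ a b d e → (a ℚ.+ b ℚ.* d) ℚ.* e ≡ a ℚ.* e ℚ.+ b ℚ.* (d ℚ.* e)
  distrib = solve 4 (λ a b d e → (a :+ b :* d) :* e := a :* e :+ b :* (d :* e)) refl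

-- The Cauchy property is needed here: for arbitrary sequences of rationals,
-- q ≤ x only says that x is not eventually bounded away below q.
eventuallyAbove : ∀ x q → fromℚ q ≤ x → ∀ ε → 0ℚ ℚ.< ε →
  ∃[ N ] ∀ m → N ℕ.≤ m → q ℚ.< seq x m ℚ.+ ε
eventuallyAbove x q q≤x ε 0<ε =
  let N , close = cauchy x η 0<η
      q<xN+2η : q ℚ.< seq x N ℚ.+ (η ℚ.+ η)
      -- If the term at `N` were at most `q - 2η`, closeness would keep all later terms below
      -- `q - η`, which makes `x < fromℚ q` with gap `η`.
      q<xN+2η = ℚ.≰⇒> λ xN+2η≤q → q≤x (η , 0<η , N , λ m N≤m →
        ℚ.≤-trans (ℚ.+-monoˡ-≤ η (ℚ.<⇒≤ (within (seq x m) (seq x N) (close m N N≤m ℕ.≤-refl))))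
          (ℚ.≤-trans (ℚ.≤-reflexive (ℚ.+-assoc (seq x N) η η)) xN+2η≤q))
  in  N , λ m N≤m → begin-strict
    q                                  <⟨ q<xN+2η ⟩
    seq x N ℚ.+ (η ℚ.+ η)              <⟨ ℚ.+-monoˡ-< (η ℚ.+ η) (within (seq x N) (seq x m) (close N m ℕ.≤-refl N≤m)) ⟩
    seq x m ℚ.+ η ℚ.+ (η ℚ.+ η)        ≡⟨ thirds (seq x m) ε ⟩
    seq x m ℚ.+ ε                      ∎
  where
  open ℚ.≤-Reasoning
  ⅓ η : ℚ
  ⅓ = 1ℤ / 3
  -- Two thirds of `ε` pay for the bound at index `N`, one third for passing from `N` to `m`.
  η = ε ℚ.* ⅓
  0<η : 0ℚ ℚ.< η
  0<η = 0<*-pos ⅓ 0<ε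
  thirds : ∀ a e → a ℚ.+ e ℚ.* ⅓ ℚ.+ (e ℚ.* ⅓ ℚ.+ e ℚ.* ⅓) ≡ a ℚ.+ e
  thirds = solve 2 (λ a e → a :+ e :* con ⅓ :+ (e :* con ⅓ :+ e :* con ⅓) := a :+ e) refl
  sub-add : ∀ a b → a ≡ b ℚ.+ (a ℚ.- b)
  sub-add = solve 2 (λ a b → a := b :+ (a :- b)) refl
  within : ∀ a b → ℚ.∣ a ℚ.- b ∣ ℚ.< η → a ℚ.< b ℚ.+ η
  within a b ∣a-b∣<η = begin-strict
    a                ≡⟨ sub-add a b ⟩
    b ℚ.+ (a ℚ.- b)  <⟨ ℚ.+-monoʳ-< b (ℚ.≤-<-trans (p≤∣p∣ (a ℚ.- b)) ∣a-b∣<η) ⟩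
    b ℚ.+ η          ∎

-- Floors of natural multiples of a real.

⌊⌋-unique : ∀ x {i j} → ⌊ x ⌋≡ i → ⌊ x ⌋≡ j → i ≡ j
⌊⌋-unique x (i≤x , x<i+1) (j≤x , x<j+1) =
  ℤ.≤-antisym (ℤ.≮⇒≥ (i≤x ∘ below x<j+1)) (ℤ.≮⇒≥ (j≤x ∘ below x<i+1))
  where
  -- Of two distinct floors `k < l`, the smaller gives `x < k + 1 ≤ l`, against the lower bound
  -- `l ≤ x`.
  below : ∀ {k l} → x < fromℤ (k ℤ.+ 1ℤ) → k ℤ.< l → x < fromℤ l
  below {k} {l} x<k+1 k<l = <-fromℚ-trans x x<k+1 (/1-mono-≤
    (subst (ℤ._≤ l) (ℤ.+-comm 1ℤ k) (ℤ.i<j⇒suc[i]≤j k<l)))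

-- Excludes the multiplier 0 for nonzero elements of `S`.
⌊x*0⌋≡0 : ∀ x → ⌊ x * fromℕ 0 ⌋≡ 0ℤ
⌊x*0⌋≡0 x =
  (λ { (ε , 0<ε , N , x0+ε≤0) → ℚ.<-irrefl refl (ℚ.<-≤-trans 0<ε
         (subst (ℚ._≤ 0ℚ) (absorb (seq x N) ε) (x0+ε≤0 N ℕ.≤-refl))) }) ,
  (1ℚ , ℚ.positive⁻¹ 1ℚ , 0 , λ m _ → ℚ.≤-reflexive (absorb (seq x m) 1ℚ))
  where
  absorb : ∀ a e → a ℚ.* 0ℚ ℚ.+ e ≡ e
  absorb = solve 2 (λ a e → a :* con 0ℚ :+ e := e) refl

-- If `n < k`, then `xn + 1 ≤ x(n + 1) ≤ xk < i + 1 ≤ j + 1`, hence `xn < j`, against `j ≤ xn`.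
⌊x*k⌋-cancel-≤ : ∀ x → x ≥ fromℕ 1 → ∀ {k n i j} →
  ⌊ x * fromℕ k ⌋≡ i → ⌊ x * fromℕ n ⌋≡ j → i ℤ.≤ j → k ℕ.≤ n
⌊x*k⌋-cancel-≤ x x≥1 {k} {n} {i} {j} (_ , ε , 0<ε , N₁ , xk+ε≤i+1) (j≤xn , _) i≤j =
  ℕ.≮⇒≥ λ n<k → j≤xn (xn<j n<k)
  where
  open ℚ.≤-Reasoning
  -- Half of the gap in `xk < i + 1` absorbs the error in `1 ≤ x`, which holds for the terms only
  -- approximately; the other half remains as the gap in `xn < j`.
  ε/2 : ℚ
  ε/2 = ε ℚ.* ½
  0<ε/2 : 0ℚ ℚ.< ε/2
  0<ε/2 = 0<*-pos ½ 0<ε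
  regroup : ∀ t a e → t ℚ.* a ℚ.+ e ℚ.* ½ ℚ.+ (t ℚ.+ e ℚ.* ½) ≡ t ℚ.* (a ℚ.+ 1ℚ) ℚ.+ e
  regroup = solve 3 (λ t a e →
    t :* a :+ e :* con ½ :+ (t :+ e :* con ½) := t :* (a :+ con 1ℚ) :+ e) refl
  xn<j : n ℕ.< k → x * fromℕ n < fromℤ j
  xn<j n<k =
    let N₂ , 1<x+ε/2 = eventuallyAbove x 1ℚ x≥1 ε/2 0<ε/2
        -- Slack 1 makes the terms nonnegative, so that `n + 1 ≤ k` can be multiplied by them.
        N₃ , 1<x+1   = eventuallyAbove x 1ℚ x≥1 1ℚ (ℚ.positive⁻¹ 1ℚ)
        N₂₃          = N₂ ℕ.⊔ N₃
    in  ε/2 , 0<ε/2 , N₁ ℕ.⊔ N₂₃ , λ m N≤m →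
      let N₂₃≤m = ℕ.m⊔n≤o⇒n≤o N₁ N₂₃ N≤m
      in step (seq x m)
           (xk+ε≤i+1 m (ℕ.m⊔n≤o⇒m≤o N₁ N₂₃ N≤m))
           (1<x+ε/2 m (ℕ.m⊔n≤o⇒m≤o N₂ N₃ N₂₃≤m))
           (1<x+1 m (ℕ.m⊔n≤o⇒n≤o N₂ N₃ N₂₃≤m))
    where
    n+1≤k : ℤ.+ n / 1 ℚ.+ 1ℚ ℚ.≤ ℤ.+ k / 1
    n+1≤k = ℚ.≤-trans (ℚ.≤-reflexive (sym (/1-homo-+ (ℤ.+ n) 1ℤ)))
      (/1-mono-≤ (ℤ.+≤+ (subst (ℕ._≤ k) (ℕ.+-comm 1 n) n<k)))
    step : ∀ t → t ℚ.* (ℤ.+ k / 1) ℚ.+ ε ℚ.≤ (i ℤ.+ 1ℤ) / 1 →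
      1ℚ ℚ.< t ℚ.+ ε/2 → 1ℚ ℚ.< t ℚ.+ 1ℚ →
      t ℚ.* (ℤ.+ n / 1) ℚ.+ ε/2 ℚ.≤ j / 1
    step t tk+ε≤i+1 1<t+ε/2 1<t+1 = +-cancelʳ-≤ 1ℚ (begin
      t ℚ.* (ℤ.+ n / 1) ℚ.+ ε/2 ℚ.+ 1ℚ
        ≤⟨ ℚ.+-monoʳ-≤ (t ℚ.* (ℤ.+ n / 1) ℚ.+ ε/2) (ℚ.<⇒≤ 1<t+ε/2) ⟩
      t ℚ.* (ℤ.+ n / 1) ℚ.+ ε/2 ℚ.+ (t ℚ.+ ε/2)
        ≡⟨ regroup t (ℤ.+ n / 1) ε ⟩
      t ℚ.* (ℤ.+ n / 1 ℚ.+ 1ℚ) ℚ.+ ε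
        ≤⟨ ℚ.+-monoˡ-≤ ε (ℚ.*-monoˡ-≤-nonNeg t {{ℚ.nonNegative 0≤t}} n+1≤k) ⟩
      t ℚ.* (ℤ.+ k / 1) ℚ.+ ε
        ≤⟨ tk+ε≤i+1 ⟩
      (i ℤ.+ 1ℤ) / 1
        ≤⟨ /1-mono-≤ (ℤ.+-monoˡ-≤ 1ℤ i≤j) ⟩
      (j ℤ.+ 1ℤ) / 1
        ≡⟨ /1-homo-+ j 1ℤ ⟩
      j / 1 ℚ.+ 1ℚ ∎)
      where
      0≤t : 0ℚ ℚ.≤ t
      0≤t = +-cancelʳ-≤ 1ℚ (ℚ.≤-trans (ℚ.≤-reflexive (ℚ.+-identityˡ 1ℚ)) (ℚ.<⇒≤ 1<t+1))

-- Pigeonhole principle for labelled lists.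

lookup-injective : ∀ {a} {A : Set a} {xs : List A} → Unique xs →
  ∀ i j → lookup xs i ≡ lookup xs j → i ≡ j
lookup-injective (x∉xs ∷ xs!) zero    zero    _  = refl
lookup-injective (x∉xs ∷ xs!) zero    (suc j) eq = contradiction eq (All.lookup x∉xs (∈-lookup j))
lookup-injective (x∉xs ∷ xs!) (suc i) zero    eq = contradiction (sym eq) (All.lookup x∉xs (∈-lookup i))
lookup-injective (x∉xs ∷ xs!) (suc i) (suc j) eq = cong suc (lookup-injective xs! i j eq)

-- Sending each position to its chosen label is an injection into `Fin n`: equal labels give equal
-- elements by `R-inj`, and these sit at equal positions by uniqueness. Labels are given by a
-- relation because the floor is one.
length≤ : ∀ {a r} {A : Set a} {R : A → ℕ → Set r} {n} {xs : List A} →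
  Unique xs → All (λ x → ∃[ k ] k ℕ.< n × R x k) xs →
  (∀ {x y k} → R x k → R y k → x ≡ y) → length xs ℕ.≤ n
length≤ {R = R} {xs = xs} xs! labels R-inj = injective⇒≤ λ {i} {j} eq →
  let k , k<n , Rk = label i
      l , l<n , Rl = label j
  -- The map into `Fin n` is never written out; unification reads it off the arguments of
  -- `fromℕ<-injective`.
  in  lookup-injective xs! i j
        (R-inj Rk (subst (R (lookup xs j)) (sym (fromℕ<-injective k l k<n l<n eq)) Rl))
  where
  label : ∀ i → _
  label i = All.lookup labels (∈-lookup {xs = xs} i)

proposition9 : (τ : ℝ) → τ ≥ fromℕ 1 →
    (S : List ℤ) → Unique S →
    All (λ i → ∃[ k ] ⌊ τ * fromℕ k ⌋≡ i) S →
    Any (_≢ 0ℤ) S →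
    (x̂ : ℤ) (n̂ : ℕ) → IsLargestIn x̂ S → ⌊ τ * fromℕ n̂ ⌋≡ x̂ →
    (n : ℕ) → n ≡ countNonzero S →
    Σ[ n̂≢0 ∈ ℕ.NonZero n̂ ] Σ[ n≢0 ∈ ℕ.NonZero n ]
    (τ < fromℚ (((x̂ ℤ.+ 1ℤ) / n̂) {{n̂≢0}})) ×
    (fromℚ (((x̂ ℤ.+ 1ℤ) / n̂) {{n̂≢0}}) ≤ fromℚ (((x̂ ℤ.+ 1ℤ) / n) {{n≢0}}))
proposition9 τ τ≥1 S S! floors nonzero x̂ n̂ (_ , S≤x̂) ⌊τn̂⌋≡x̂ n refl =
  n̂≢0 , n≢0 , τ<q̂ , fromℚ-mono-≤ q̂≤q
  where
  nonzero? = λ i → ¬? (i ℤ.≟ 0ℤ)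

  -- The multipliers 1 to `n̂` are labelled by their predecessors, which are the numbers below `n̂`;
  -- `suc k ≤ n̂` is `k < n̂` by definition.
  label : ∀ {i} → i ℤ.≤ x̂ → i ≢ 0ℤ → ∃[ k ] ⌊ τ * fromℕ k ⌋≡ i →
    ∃[ k ] k ℕ.< n̂ × ⌊ τ * fromℕ (suc k) ⌋≡ i
  label i≤x̂ i≢0 (zero  , ⌊τ0⌋≡i) =
    contradiction (⌊⌋-unique (τ * fromℕ 0) ⌊τ0⌋≡i (⌊x*0⌋≡0 τ)) i≢0
  label i≤x̂ i≢0 (suc k , ⌊τk⌋≡i) =
    k , ⌊x*k⌋-cancel-≤ τ τ≥1 ⌊τk⌋≡i ⌊τn̂⌋≡x̂ i≤x̂ , ⌊τk⌋≡i

  labels : All (λ i → ∃[ k ] k ℕ.< n̂ × ⌊ τ * fromℕ (suc k) ⌋≡ i) (filter nonzero? S)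
  labels = All.zipWith (λ { (i≢0 , i≤x̂ , floor) → label i≤x̂ i≢0 floor })
    (All.all-filter nonzero? S , All.filter⁺ nonzero? (All.zip (S≤x̂ , floors)))

  n≤n̂ : n ℕ.≤ n̂
  n≤n̂ = length≤ {R = λ i k → ⌊ τ * fromℕ (suc k) ⌋≡ i}
    (Unique.filter⁺ nonzero? S!) labels
    λ {_} {_} {k} → ⌊⌋-unique (τ * fromℕ (suc k))

  0<n : 0 ℕ.< n
  0<n = filter-some nonzero? nonzero

  n≢0 : ℕ.NonZero n
  n≢0 = ℕ.>-nonZero 0<n

  n̂≢0 : ℕ.NonZero n̂
  n̂≢0 = ℕ.>-nonZero (ℕ.<-≤-trans 0<n n≤n̂)

  instance
    _ = n≢0
    _ = n̂≢0

  τ<q̂ : τ < fromℚ ((x̂ ℤ.+ 1ℤ) / n̂)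
  -- The floor condition gives `τ n̂ < x̂ + 1`; its right side is rewritten as the quotient times
  -- `n̂`, and `n̂` is cancelled.
  τ<q̂ = *-cancelʳ-<-fromℚ τ ((x̂ ℤ.+ 1ℤ) / n̂) (ℤ.+ n̂ / 1)
    {{ℚ.normalize-pos n̂ 1}}
    (subst (λ q → τ * fromℕ n̂ < fromℚ q) (sym (/-*-cancel (x̂ ℤ.+ 1ℤ) n̂)) (proj₂ ⌊τn̂⌋≡x̂))

  -- Passing to the smaller denominator `n` enlarges the quotient only for a nonnegative numerator.
  -- A negative one would give `τ < (x̂ + 1) / n̂ ≤ 1`.
  0≤x̂+1 : 0ℤ ℤ.≤ x̂ ℤ.+ 1ℤ
  0≤x̂+1 = ℤ.≮⇒≥ λ x̂+1<0 → τ≥1 (<-fromℚ-trans τ τ<q̂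
    (/-mono-≤ (x̂ ℤ.+ 1ℤ) 1ℤ n̂ 1 (ℤ.≤-trans
      (ℤ.*-monoʳ-≤-nonNeg 1ℤ (ℤ.<⇒≤ x̂+1<0))
      (ℤ.*-monoʳ-≤-nonNeg (ℤ.+ n̂) (ℤ.+≤+ (ℕ.z≤n {1}))))))

  q̂≤q : (x̂ ℤ.+ 1ℤ) / n̂ ℚ.≤ (x̂ ℤ.+ 1ℤ) / n
  q̂≤q = /-mono-≤ (x̂ ℤ.+ 1ℤ) (x̂ ℤ.+ 1ℤ) n̂ n
    (ℤ.*-monoˡ-≤-nonNeg (x̂ ℤ.+ 1ℤ) {{ℤ.nonNegative 0≤x̂+1}} (ℤ.+≤+ n≤n̂))
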